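{- Let $N$ be a positive integer which is not a perfect square and let $q$ be a positive integer dividing $N$ with $N>q^2$; put $\alpha=\frac{\sqrt N}{q}$ (that is, $p=0$). Let $[a_0,a_1,a_2,\dots]$ be the continued fraction expansion of $\alpha$ with sequence of complete quotients $(\zeta_n)_{n\ge0}$, and let $(y_n)_{n\ge0}$ and $(t_n)_{n\ge0}$ be the sequences of direction-change values and of step counts of the left-positive path (LPP) of $\alpha$. Then, for every non-negative integer $n$: - $\zeta_n=-y_n^*$ if $n$ is even and $\zeta_n=-\frac{1}{y_n^*}$ if $n$ is odd; - $a_n=t_n$.
   Context: General setting: $N$ is a positive integer which is not a perfect square, $p$ is an integer with $p^2<N$, $q$ is a positive integer dividing $N-p^2$, and $\alpha=\frac{\sqrt N+p}{q}$ (here $p=0$). The Calkin-Wilf tree of $\alpha$ is the infinite binary tree whose root is labeled $\alpha$ and in which every vertex labeled $x$ has a left child labeled $\frac{x}{x+1}$ and a right child labeled $x+1$ (since $\alpha>0$, all labels are positive). Each vertex carries a triple $(\varepsilon,c,d)$ with $\varepsilon\in\{ -1,1\}$, $c$ an integer, $d$ a positive integer dividing $N-c^2$, and label equal to $\frac{\varepsilon\sqrt N+c}{d}$, defined as follows. The root has triple $(1,p,q)$. If a vertex has triple $(\varepsilon,c,d)$, its right child has triple $(\varepsilon,c+d,d)$; its left child has triple $\left(-\varepsilon,\frac{N-c^2}{d}-c,\frac{N-(c+d)^2}{d}\right)$ if $N-(c+d)^2>0$, and $\left(\varepsilon,c-\frac{N-c^2}{d},\frac{(c+d)^2-N}{d}\right)$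 otherwise. The left-positive path (LPP) of $\alpha$ is the infinite descending path which starts at the root and which, from each vertex, goes to the left child if the value of $\varepsilon$ for that left child is $1$, and to the right child otherwise. $x_n$ denotes the label of the $n$-th vertex of the LPP, with $x_0=\alpha$. Put $s_n=\ell$ if the step from $x_n$ to $x_{n+1}$ goes to the left child, and $s_n=r$ if it goes to the right child. Direction changes: put $\varphi(0)=0$ and, for $n\ge0$, let $\varphi(n+1)$ be the least integer $k>\varphi(n)$ with $s_{k-1}\ne s_k$ (such $k$ always exists). Put $y_n=x_{\varphi(n)}$ and $t_n=\varphi(n+1)-\varphi(n)$. For rational numbers $a,b$, the algebraic conjugate of $x=a\sqrt N+b$ is $x^*=-a\sqrt N+b$. The (regular) continued fraction expansion of $\alpha$ is defined by $\zeta_0=\alpha$, $a_0=\lfloor\zeta_0\rfloor$ and, for every integer $n\ge0$, $\zeta_{n+1}=\frac{1}{\zeta_n-a_n}$, $a_{n+1}=\lfloor\zeta_{n+1}\rfloor$; the $\zeta_n$ are the complete quotients. -}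

module Defs where

open import Data.Integer as ℤ using (ℤ; +_; 0ℤ; 1ℤ)
open import Data.Integer.Divisibility.Signed as ℤ∣ using (divides)
open import Data.Integer.Properties as ℤₚ using ()
open import Data.Integer.Tactic.RingSolver using (solve-∀)
open import Data.Nat as ℕ using (ℕ; zero; suc)
open import Data.Nat.Divisibility as ℕ∣ using ()
open import Data.Product using (_×_; _,_)
open import Data.Rational as ℚ using (ℚ; 0ℚ)
open import Data.Sign as Sign using (Sign)
open import Data.Sum using (_⊎_)
open import Relation.Binary.PropositionalEquality using (_≡_; _≢_; sym; trans; cong; subst)
open import Relation.Nullary using (yes; no)

NonSquare : ℕ → Set
NonSquare N = ∀ m → m ℕ.* m ≢ N

-- ⟨ a , b ⟩ stands for the real number a√N + b.  For non-square N the
-- coefficients are determined by that number, so _≡_ is equality of reals.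
-- The operations and the order below are those of ℝ restricted to ℚ(√N).

infix 4 ⟨_,_⟩

record ℚ√ (N : ℕ) : Set where
  constructor ⟨_,_⟩
  field
    irr rat : ℚ

module _ {N : ℕ} where

  private
    N′ : ℚ
    N′ = + N ℚ./ 1

  fromℤ : ℤ → ℚ√ N
  fromℤ m = ⟨ 0ℚ , m ℚ./ 1 ⟩

  infixl 6 _⊕_ _⊖_
  infixl 7 _⊗_
  infix  8 ⊝_
  infix  9 _*̄

  _⊕_ _⊖_ _⊗_ : ℚ√ N → ℚ√ N → ℚ√ N
  ⟨ a , b ⟩ ⊕ ⟨ a′ , b′ ⟩ = ⟨ a ℚ.+ a′ , b ℚ.+ b′ ⟩
  ⟨ a , b ⟩ ⊖ ⟨ a′ , b′ ⟩ = ⟨ a ℚ.- a′ , b ℚ.- b′ ⟩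
  ⟨ a , b ⟩ ⊗ ⟨ a′ , b′ ⟩ =
    ⟨ a ℚ.* b′ ℚ.+ b ℚ.* a′ , a ℚ.* a′ ℚ.* N′ ℚ.+ b ℚ.* b′ ⟩

  ⊝_ : ℚ√ N → ℚ√ N
  ⊝ ⟨ a , b ⟩ = ⟨ ℚ.- a , ℚ.- b ⟩

  _*̄ : ℚ√ N → ℚ√ N
  ⟨ a , b ⟩ *̄ = ⟨ ℚ.- a , b ⟩

  -- The rational number x ⊗ x *̄.
  norm : ℚ√ N → ℚ
  norm ⟨ a , b ⟩ = b ℚ.* b ℚ.- a ℚ.* a ℚ.* N′

  -- The inverse x *̄ / norm x.  For non-square N the norm vanishes only at
  -- x = 0, where the value is set to 0.
  infix 8 _⁻¹
  _⁻¹ : ℚ√ N → ℚ√ N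
  x@(⟨ a , b ⟩) ⁻¹ with norm x ℚ.≟ 0ℚ
  ... | yes _ = ⟨ 0ℚ , 0ℚ ⟩
  ... | no ≢0 = ⟨ ℚ.- a ℚ.* n⁻¹ , b ℚ.* n⁻¹ ⟩
    where
    n⁻¹ : ℚ
    n⁻¹ = ℚ.1/_ (norm x) {{ℚ.≢-nonZero ≢0}}

  -- a√N + b ≥ 0 in ℝ; when a and b have opposite signs, |a|√N and |b| are
  -- compared through their squares.
  NonNeg : ℚ√ N → Set
  NonNeg ⟨ a , b ⟩ =
      (0ℚ ℚ.≤ a × 0ℚ ℚ.≤ b)
    ⊎ (0ℚ ℚ.≤ a × b ℚ.≤ 0ℚ × b ℚ.* b ℚ.≤ a ℚ.* a ℚ.* N′)
    ⊎ (a ℚ.≤ 0ℚ × 0ℚ ℚ.≤ b × a ℚ.* a ℚ.* N′ ℚ.≤ b ℚ.* b)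

  infix 4 _≼_ _≺_
  _≼_ _≺_ : ℚ√ N → ℚ√ N → Set
  x ≼ y = NonNeg (y ⊖ x)
  x ≺ y = x ≼ y × x ≢ y

  -- m = ⌊ x ⌋
  IsFloor : ℚ√ N → ℤ → Set
  IsFloor x m = fromℤ m ≼ x × x ≺ fromℤ (m ℤ.+ 1ℤ)

  -- a: partial quotients, ζ: complete quotients.
  record IsContinuedFraction (α : ℚ√ N) (a : ℕ → ℤ) (ζ : ℕ → ℚ√ N) : Set where
    field
      ζ-zero  : ζ 0 ≡ α
      ζ-suc   : ∀ n → ζ (suc n) ≡ (ζ n ⊖ fromℤ (a n)) ⁻¹
      a-floor : ∀ n → IsFloor (ζ n) (a n)

data Direction : Set where
  ℓ r : Direction

data Vertex : Set where
  root  : Vertex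
  child : Direction → Vertex → Vertex

label : ∀ {N} → ℚ√ N → Vertex → ℚ√ N
label α root        = α
label α (child ℓ v) = label α v ⊗ (label α v ⊕ fromℤ 1ℤ) ⁻¹
label α (child r v) = label α v ⊕ fromℤ 1ℤ

private
  neg-* : ∀ x y → ℤ.- (x ℤ.* y) ≡ ℤ.- x ℤ.* y
  neg-* = solve-∀

  decompose : ∀ n x → n ≡ (n ℤ.- x) ℤ.+ x
  decompose = solve-∀

  shift-eq : ∀ c d e →
    (e ℤ.* d ℤ.+ c ℤ.* c) ℤ.- (c ℤ.+ d) ℤ.* (c ℤ.+ d) ≡ (e ℤ.- c ℤ.- c ℤ.- d) ℤ.* d
  shift-eq = solve-∀

  flipped-eq : ∀ c d e →
    (e ℤ.* d ℤ.+ c ℤ.* c) ℤ.- (e ℤ.- c) ℤ.* (e ℤ.- c)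
      ≡ ℤ.- e ℤ.* (e ℤ.- c ℤ.- c ℤ.- d)
  flipped-eq = solve-∀

  kept-eq : ∀ c d e →
    (e ℤ.* d ℤ.+ c ℤ.* c) ℤ.- (c ℤ.- e) ℤ.* (c ℤ.- e)
      ≡ e ℤ.* (ℤ.- (e ℤ.- c ℤ.- c ℤ.- d))
  kept-eq = solve-∀

  pos-quotient : ∀ {d z k} → 0ℤ ℤ.< d → 0ℤ ℤ.< z → z ≡ k ℤ.* d → 0ℤ ℤ.< k
  pos-quotient {d} {z} {k} d>0 z>0 eq =
    ℤₚ.*-cancelʳ-<-nonNeg d {{ℤ.nonNegative (ℤₚ.<⇒≤ d>0)}}
      (subst (ℤ._< k ℤ.* d) (sym (ℤₚ.*-zeroˡ d)) (subst (0ℤ ℤ.<_) eq z>0))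

-- Carried by a vertex whose label is (ε√N + c)/d.
record Triple (N : ℕ) : Set where
  field
    ε   : Sign
    c d : ℤ
    d>0 : 0ℤ ℤ.< d
    d∣  : d ℤ∣.∣ + N ℤ.- c ℤ.* c

  -- The exact quotients e = (N - c²)/d and f = (N - (c + d)²)/d.
  e f : ℤ
  e = ℤ∣.quotient d∣
  f = e ℤ.- c ℤ.- c ℤ.- d

  N-eq : + N ≡ e ℤ.* d ℤ.+ c ℤ.* c
  N-eq = trans (decompose (+ N) (c ℤ.* c)) (cong (ℤ._+ c ℤ.* c) (ℤ∣._∣_.equality d∣))

  f-eq : + N ℤ.- (c ℤ.+ d) ℤ.* (c ℤ.+ d) ≡ f ℤ.* d
  f-eq = trans (cong (ℤ._- (c ℤ.+ d) ℤ.* (c ℤ.+ d)) N-eq) (shift-eq c d e)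

module _ {N : ℕ} (nonSquare : NonSquare N) where

  private
    N≢square : ∀ z → + N ℤ.- z ℤ.* z ≢ 0ℤ
    N≢square z eq = nonSquare ℤ.∣ z ∣
      (trans (sym (ℤₚ.abs-* z z)) (cong ℤ.∣_∣ (sym (ℤₚ.i-j≡0⇒i≡j (+ N) (z ℤ.* z) eq))))

  rightTriple : Triple N → Triple N
  rightTriple t = record
    { ε   = ε
    ; c   = c ℤ.+ d
    ; d   = d
    ; d>0 = d>0
    ; d∣  = divides f f-eq
    }
    where open Triple t

  leftTriple : Triple N → Triple N
  leftTriple t with 0ℤ ℤ.<? + N ℤ.- (Triple.c t ℤ.+ Triple.d t) ℤ.* (Triple.c t ℤ.+ Triple.d t)
  ... | yes pos = record
    { ε   = Sign.opposite ε
    ; c   = e ℤ.- c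
    ; d   = f
    ; d>0 = pos-quotient d>0 pos f-eq
    ; d∣  = divides (ℤ.- e)
              (trans (cong (ℤ._- (e ℤ.- c) ℤ.* (e ℤ.- c)) N-eq) (flipped-eq c d e))
    }
    where open Triple t
  ... | no ¬pos = record
    { ε   = ε
    ; c   = c ℤ.- e
    ; d   = ℤ.- f
    ; d>0 = pos-quotient d>0
              (ℤₚ.neg-mono-< (ℤₚ.≤∧≢⇒< (ℤₚ.≮⇒≥ ¬pos) (N≢square (c ℤ.+ d))))
              (trans (cong ℤ.-_ f-eq) (neg-* f d))
    ; d∣  = divides e
              (trans (cong (ℤ._- (c ℤ.- e) ℤ.* (c ℤ.- e)) N-eq) (kept-eq c d e))
    }
    where open Triple t

  triple : Triple N → Vertex → Triple N
  triple t₀ root        = t₀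
  triple t₀ (child ℓ v) = leftTriple (triple t₀ v)
  triple t₀ (child r v) = rightTriple (triple t₀ v)

  step : Triple N → Vertex → Direction
  step t₀ v with Triple.ε (triple t₀ (child ℓ v))
  ... | Sign.+ = ℓ
  ... | Sign.- = r

  lpp : Triple N → ℕ → Vertex
  lpp t₀ zero    = root
  lpp t₀ (suc n) = child (step t₀ (lpp t₀ n)) (lpp t₀ n)

-- φ enumerates 0 followed by the indices k ≥ 1 with s (k - 1) ≢ s k.
record IsDirectionChanges (s : ℕ → Direction) (φ : ℕ → ℕ) : Set where
  field
    φ-zero   : φ 0 ≡ 0
    φ-<      : ∀ n → φ n ℕ.< φ (suc n)
    φ-change : ∀ n → s (φ (suc n) ℕ.∸ 1) ≢ s (φ (suc n))
    φ-least  : ∀ n k → φ n ℕ.< k → s (k ℕ.∸ 1) ≢ s k → φ (suc n) ℕ.≤ k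

infix 9 √_/_
√_/_ : (N q : ℕ) .{{_ : ℕ.NonZero q}} → ℚ√ N
√ N / q = ⟨ + 1 ℚ./ q , 0ℚ ⟩

rootTriple : ∀ {N} q .{{_ : ℕ.NonZero q}} → q ℕ∣.∣ N → Triple N
rootTriple {N} q@(suc _) q∣N = record
  { ε   = Sign.+
  ; c   = 0ℤ
  ; d   = + q
  ; d>0 = ℤ.+<+ (ℕ.s≤s ℕ.z≤n)
  ; d∣  = subst (+ q ℤ∣.∣_) (sym (ℤₚ.+-identityʳ (+ N))) (ℤ∣.∣ᵤ⇒∣ q∣N)
  }

module LPP {N : ℕ} (nonSquare : NonSquare N)
           (q : ℕ) .{{_ : ℕ.NonZero q}} (q∣N : q ℕ∣.∣ N) where

  path : ℕ → Vertex
  path = lpp nonSquare (rootTriple q q∣N)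

  x : ℕ → ℚ√ N
  x n = label (√ N / q) (path n)

  s : ℕ → Direction
  s n = step nonSquare (rootTriple q q∣N) (path n)

{-# OPTIONS --safe #-}

-- Every vertex x = (√N + c)/d of the path has ε = 1 and c² < N, so u = −x* is
-- positive.  A step to the right replaces u by u − 1 and is taken exactly when
-- u > 1; a step to the left replaces 1/u by 1/u − 1 and is taken when u < 1.
-- Thus the path runs the subtractive Euclidean algorithm on u: a maximal run
-- of steps in one direction subtracts the integer part, and a change of
-- direction replaces the remaining fractional part by its inverse.  This is
-- the continued fraction algorithm, started at u = α because p = 0.
-- The involution (c, d, e) ↦ (−c, e, d), where e = (N − c²)/d, turns u into
-- 1/u and exchanges the two kinds of step, so one argument serves both.

module Submission where

open import Defs
open import Data.Integer as ℤ using (ℤ; +_; 0ℤ; 1ℤ)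
import Data.Integer.Properties as ℤₚ
open import Data.Integer.Tactic.RingSolver using (solve-∀)
open import Data.Nat as ℕ using (ℕ; zero; suc; _*_; _∸_; _<_; NonZero; z≤n; s≤s)
open import Data.Nat.Divisibility as ℕ∣ using (_∣_)
import Data.Nat.Properties as ℕₚ
open import Data.Product using (_×_; _,_; proj₁; proj₂)
open import Data.Rational as ℚ using (ℚ; 0ℚ; 1ℚ)
import Data.Rational.Properties as ℚₚ
open import Data.Rational.Solver using (module +-*-Solver)
import Data.Rational.Unnormalised as ℚᵘ
import Data.Rational.Unnormalised.Properties as ℚᵘₚ
open import Data.Sign as Sign using (Sign)
open import Data.Sum using (_⊎_; inj₁; inj₂)
open import Relation.Binary.Definitions using (tri<; tri≈; tri>)
open import Relation.Binary.PropositionalEquality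
open import Relation.Nullary using (¬_; Dec; yes; no; contradiction)

-- Integers inside the rationals, and clearing denominators.

ι : ℤ → ℚ
ι z = z ℚ./ 1

toℚᵘ-ι : ∀ z → ℚ.toℚᵘ (ι z) ℚᵘ.≃ ℚᵘ.mkℚᵘ z 0
toℚᵘ-ι z = ℚₚ.toℚᵘ-fromℚᵘ (ℚᵘ.mkℚᵘ z 0)

ι-injective : ∀ {i j} → ι i ≡ ι j → i ≡ j
ι-injective {i} {j} eq with ℚₚ.fromℚᵘ-injective {ℚᵘ.mkℚᵘ i 0} {ℚᵘ.mkℚᵘ j 0} eq
... | ℚᵘ.*≡* i*1≡j*1 = trans (sym (ℤₚ.*-identityʳ i)) (trans i*1≡j*1 (ℤₚ.*-identityʳ j))

ι-cancel-≤ : ∀ {i j} → ι i ℚ.≤ ι j → i ℤ.≤ j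
ι-cancel-≤ {i} {j} le
  with ℚᵘₚ.≤-respˡ-≃ (toℚᵘ-ι i) (ℚᵘₚ.≤-respʳ-≃ (toℚᵘ-ι j) (ℚₚ.toℚᵘ-mono-≤ le))
... | ℚᵘ.*≤* i*1≤j*1 = subst₂ ℤ._≤_ (ℤₚ.*-identityʳ i) (ℤₚ.*-identityʳ j) i*1≤j*1

ι-+ : ∀ i j → ι (i ℤ.+ j) ≡ ι i ℚ.+ ι j
ι-+ i j = ℚₚ.toℚᵘ-injective (begin
  ℚ.toℚᵘ (ι (i ℤ.+ j))                  ≈⟨ toℚᵘ-ι (i ℤ.+ j) ⟩
  ℚᵘ.mkℚᵘ (i ℤ.+ j) 0                   ≈⟨ ℚᵘ.*≡* (lemma i j) ⟩
  ℚᵘ.mkℚᵘ i 0 ℚᵘ.+ ℚᵘ.mkℚᵘ j 0          ≈⟨ ℚᵘₚ.+-cong (toℚᵘ-ι i) (toℚᵘ-ι j) ⟨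
  ℚ.toℚᵘ (ι i) ℚᵘ.+ ℚ.toℚᵘ (ι j)        ≈⟨ ℚₚ.toℚᵘ-homo-+ (ι i) (ι j) ⟨
  ℚ.toℚᵘ (ι i ℚ.+ ι j)                  ∎)
  where
  open import Relation.Binary.Reasoning.Setoid ℚᵘₚ.≃-setoid
  lemma : ∀ i j → (i ℤ.+ j) ℤ.* 1ℤ ≡ (i ℤ.* 1ℤ ℤ.+ j ℤ.* 1ℤ) ℤ.* 1ℤ
  lemma = solve-∀

ι-* : ∀ i j → ι (i ℤ.* j) ≡ ι i ℚ.* ι j
ι-* i j = ℚₚ.toℚᵘ-injective (begin
  ℚ.toℚᵘ (ι (i ℤ.* j))                  ≈⟨ toℚᵘ-ι (i ℤ.* j) ⟩
  ℚᵘ.mkℚᵘ i 0 ℚᵘ.* ℚᵘ.mkℚᵘ j 0          ≈⟨ ℚᵘₚ.*-cong (toℚᵘ-ι i) (toℚᵘ-ι j) ⟨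
  ℚ.toℚᵘ (ι i) ℚᵘ.* ℚ.toℚᵘ (ι j)        ≈⟨ ℚₚ.toℚᵘ-homo-* (ι i) (ι j) ⟨
  ℚ.toℚᵘ (ι i ℚ.* ι j)                  ∎)
  where open import Relation.Binary.Reasoning.Setoid ℚᵘₚ.≃-setoid

open ≡-Reasoning
open +-*-Solver using (solve; _:=_; _:+_; _:*_; _:-_; :-_; con)

ι-neg : ∀ i → ι (ℤ.- i) ≡ ℚ.- ι i
ι-neg i = begin
  ι (ℤ.- i)                            ≡⟨ lemma (ι (ℤ.- i)) (ι i) ⟩
  (ι (ℤ.- i) ℚ.+ ι i) ℚ.- ι i          ≡⟨ cong (ℚ._- ι i) (ι-+ (ℤ.- i) i) ⟨
  ι (ℤ.- i ℤ.+ i) ℚ.- ι i              ≡⟨ cong (λ z → ι z ℚ.- ι i) (ℤₚ.+-inverseˡ i) ⟩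
  0ℚ ℚ.- ι i                           ≡⟨ ℚₚ.+-identityˡ (ℚ.- ι i) ⟩
  ℚ.- ι i                              ∎
  where
  lemma : ∀ p q → p ≡ (p ℚ.+ q) ℚ.- q
  lemma = solve 2 (λ p q → p := (p :+ q) :- q) refl

-- The inverse u of D is passed explicitly: for a surd with denominator D it is the coefficient of
-- √N, so D is invertible by the definition of a surd.
cancel-unit : ∀ {a b u D} → u ℚ.* D ≡ 1ℚ → a ℚ.* D ≡ b ℚ.* D → a ≡ b
cancel-unit {a} {b} {u} {D} unit eq = begin
  a                    ≡⟨ ℚₚ.*-identityʳ a ⟨
  a ℚ.* 1ℚ             ≡⟨ cong (a ℚ.*_) unit ⟨
  a ℚ.* (u ℚ.* D)      ≡⟨ swap a u D ⟩
  u ℚ.* (a ℚ.* D)      ≡⟨ cong (u ℚ.*_) eq ⟩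
  u ℚ.* (b ℚ.* D)      ≡⟨ swap b u D ⟨
  b ℚ.* (u ℚ.* D)      ≡⟨ cong (b ℚ.*_) unit ⟩
  b ℚ.* 1ℚ             ≡⟨ ℚₚ.*-identityʳ b ⟩
  b                    ∎
  where
  swap : ∀ a u D → a ℚ.* (u ℚ.* D) ≡ u ℚ.* (a ℚ.* D)
  swap = solve 3 (λ a u D → a :* (u :* D) := u :* (a :* D)) refl

neg-*-neg : ∀ a b → (ℚ.- a) ℚ.* (ℚ.- b) ≡ a ℚ.* b
neg-*-neg = solve 2 (λ a b → (:- a) :* (:- b) := a :* b) refl

0≰-1 : ¬ 0ℚ ℚ.≤ ℚ.- 1ℚ
0≰-1 (ℚ.*≤* ())

ι-nonNeg : ∀ {i} → 0ℤ ℤ.≤ i → ℚ.NonNegative (ι i)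
ι-nonNeg {+ n} _ = ℚₚ.normalize-nonNeg n 1

ι-*-square : ∀ p d → (p ℚ.* p) ℚ.* ι (d ℤ.* d) ≡ (p ℚ.* ι d) ℚ.* (p ℚ.* ι d)
ι-*-square p d = trans (cong ((p ℚ.* p) ℚ.*_) (ι-* d d)) (rearrange p (ι d))
  where
  rearrange : ∀ p D → (p ℚ.* p) ℚ.* (D ℚ.* D) ≡ (p ℚ.* D) ℚ.* (p ℚ.* D)
  rearrange = solve 2 (λ p D → (p :* p) :* (D :* D) := (p :* D) :* (p :* D)) refl

scale-≤ : ∀ {i} p q → 0ℤ ℤ.≤ i → p ℚ.≤ q → p ℚ.* ι i ℚ.≤ q ℚ.* ι i
scale-≤ {i} p q 0≤i = ℚₚ.*-monoʳ-≤-nonNeg (ι i) {{ι-nonNeg 0≤i}}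

scale-0≤ : ∀ {i p} → 0ℤ ℤ.≤ i → 0ℚ ℚ.≤ p → 0ℚ ℚ.≤ p ℚ.* ι i
scale-0≤ {i} {p} 0≤i 0≤p = subst (ℚ._≤ p ℚ.* ι i) (ℚₚ.*-zeroˡ (ι i)) (scale-≤ 0ℚ p 0≤i 0≤p)

0≤square : ∀ i → 0ℤ ℤ.≤ i ℤ.* i
0≤square (+ n)        = subst (0ℤ ℤ.≤_) (ℤₚ.pos-* n n) (ℤ.+≤+ z≤n)
0≤square (ℤ.-[1+ n ]) = ℤ.+≤+ z≤n

-- Multiplication by d² turns the comparison of b² with a²N in `NonNeg` into one of c² with N;
-- `irr²-scaled` treats the other side.
rat²-scaled : ∀ b {c d} → b ℚ.* ι d ≡ ι c → (b ℚ.* b) ℚ.* ι (d ℤ.* d) ≡ ι (c ℤ.* c)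
rat²-scaled b {c} {d} br =
  trans (ι-*-square b d) (trans (cong₂ ℚ._*_ br br) (sym (ι-* c c)))

irr²-scaled : ∀ a M {d} → a ℚ.* ι d ≡ 1ℚ → (a ℚ.* a ℚ.* M) ℚ.* ι (d ℤ.* d) ≡ M
irr²-scaled a M {d} ai = begin
  (a ℚ.* a ℚ.* M) ℚ.* ι (d ℤ.* d)      ≡⟨ swap (a ℚ.* a) M (ι (d ℤ.* d)) ⟩
  (a ℚ.* a) ℚ.* ι (d ℤ.* d) ℚ.* M      ≡⟨ cong (ℚ._* M) (trans (ι-*-square a d) (cong₂ ℚ._*_ ai ai)) ⟩
  1ℚ ℚ.* M                             ≡⟨ ℚₚ.*-identityˡ M ⟩
  M                                    ∎
  where
  swap : ∀ p M D → (p ℚ.* M) ℚ.* D ≡ p ℚ.* D ℚ.* M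
  swap = solve 3 (λ p M D → (p :* M) :* D := p :* D :* M) refl

-- Surds (√N + c)/d and the field operations on them.

module _ {N : ℕ} where

  -- x = (√N + c)/d, with d ≠ 0 of either sign.
  record Surd (x : ℚ√ N) (c d : ℤ) : Set where
    constructor surd
    field
      irr-scaled : ℚ√.irr x ℚ.* ι d ≡ 1ℚ
      rat-scaled : ℚ√.rat x ℚ.* ι d ≡ ι c

  -- The coefficient of √N inverts d, so cancelling d determines both coefficients. The formulas for
  -- ζ n are finally proved by comparing c and d in this way.
  surd-unique : ∀ {x y c d} → Surd x c d → Surd y c d → x ≡ y
  surd-unique {x} (surd xi xr) (surd yi yr) =
    cong₂ ⟨_,_⟩ (cancel-unit {u = ℚ√.irr x} xi (trans xi (sym yi)))
                 (cancel-unit {u = ℚ√.irr x} xi (trans xr (sym yr)))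

  surd-resp : ∀ {x c c′ d d′} → c ≡ c′ → d ≡ d′ → Surd x c d → Surd x c′ d′
  surd-resp refl refl s = s

  -- The numerator keeps √N with coefficient 1, so the sign change passes to the denominator: (-√N +
  -- c)/d = (√N - c)/(-d).
  surd-*̄ : ∀ {x c d} → Surd x c d → Surd (x *̄) (ℤ.- c) (ℤ.- d)
  surd-*̄ {⟨ a , b ⟩} {c} {d} (surd xi xr) = surd
    (trans (cong (ℚ.- a ℚ.*_) (ι-neg d)) (trans (neg-*-neg a (ι d)) xi))
    (begin
      b ℚ.* ι (ℤ.- d)    ≡⟨ cong (b ℚ.*_) (ι-neg d) ⟩
      b ℚ.* ℚ.- ι d      ≡⟨ ℚₚ.neg-distribʳ-* b (ι d) ⟨
      ℚ.- (b ℚ.* ι d)    ≡⟨ cong ℚ.-_ xr ⟩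
      ℚ.- ι c            ≡⟨ ι-neg c ⟨
      ι (ℤ.- c)          ∎)

  surd-⊝ : ∀ {x c d} → Surd x c d → Surd (⊝ x) c (ℤ.- d)
  surd-⊝ {⟨ a , b ⟩} {c} {d} (surd xi xr) = surd
    (trans (cong (ℚ.- a ℚ.*_) (ι-neg d)) (trans (neg-*-neg a (ι d)) xi))
    (trans (cong (ℚ.- b ℚ.*_) (ι-neg d)) (trans (neg-*-neg b (ι d)) xr))

  surd-⊕ : ∀ {x c d} → Surd x c d → ∀ m → Surd (x ⊕ fromℤ m) (c ℤ.+ m ℤ.* d) d
  surd-⊕ {⟨ a , b ⟩} {c} {d} (surd xi xr) m = surd
    (trans (cong (ℚ._* ι d) (ℚₚ.+-identityʳ a)) xi)
    (begin
      (b ℚ.+ ι m) ℚ.* ι d            ≡⟨ ℚₚ.*-distribʳ-+ (ι d) b (ι m) ⟩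
      b ℚ.* ι d ℚ.+ ι m ℚ.* ι d      ≡⟨ cong₂ ℚ._+_ xr (sym (ι-* m d)) ⟩
      ι c ℚ.+ ι (m ℤ.* d)            ≡⟨ ι-+ c (m ℤ.* d) ⟨
      ι (c ℤ.+ m ℤ.* d)              ∎)

  surd-⊖ : ∀ {x c d} → Surd x c d → ∀ m → Surd (x ⊖ fromℤ m) (c ℤ.- m ℤ.* d) d
  surd-⊖ {⟨ a , b ⟩} {c} {d} (surd xi xr) m = surd
    (trans (cong (ℚ._* ι d) (ℚₚ.+-identityʳ a)) xi)
    (begin
      (b ℚ.- ι m) ℚ.* ι d                ≡⟨ distrib b (ι m) (ι d) ⟩
      b ℚ.* ι d ℚ.+ ℚ.- (ι m ℚ.* ι d)    ≡⟨ cong₂ (λ p q → p ℚ.+ ℚ.- q) xr (sym (ι-* m d)) ⟩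
      ι c ℚ.+ ℚ.- ι (m ℤ.* d)            ≡⟨ cong (ι c ℚ.+_) (ι-neg (m ℤ.* d)) ⟨
      ι c ℚ.+ ι (ℤ.- (m ℤ.* d))          ≡⟨ ι-+ c (ℤ.- (m ℤ.* d)) ⟨
      ι (c ℤ.- m ℤ.* d)                  ∎)
    where
    distrib : ∀ b m d → (b ℚ.- m) ℚ.* d ≡ b ℚ.* d ℚ.+ ℚ.- (m ℚ.* d)
    distrib = solve 3 (λ b m d → (b :- m) :* d := b :* d :+ :- (m :* d)) refl

  -- As (√N + c)(√N - c) = N - c² = ed, the inverse d/(√N + c) equals (√N - c)/e.
  surd-⁻¹ : ∀ {x c d} e → e ≢ 0ℤ → + N ≡ e ℤ.* d ℤ.+ c ℤ.* c →
            Surd x c d → Surd (x ⁻¹) (ℤ.- c) e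
  surd-⁻¹ {x@(⟨ a , b ⟩)} {c} {d} e e≢0 N-eq (surd xi xr) = inverse
    where
    N≡ : ι (+ N) ≡ ι e ℚ.* ι d ℚ.+ ι c ℚ.* ι c
    N≡ = trans (cong ι N-eq) (trans (ι-+ (e ℤ.* d) (c ℤ.* c)) (cong₂ ℚ._+_ (ι-* e d) (ι-* c c)))

    expand : ∀ a b D M → (b ℚ.* b ℚ.- a ℚ.* a ℚ.* M) ℚ.* D ℚ.* (a ℚ.* D)
           ≡ a ℚ.* ((b ℚ.* D) ℚ.* (b ℚ.* D) ℚ.- (a ℚ.* D) ℚ.* (a ℚ.* D) ℚ.* M)
    expand = solve 4 (λ a b D M → (b :* b :- a :* a :* M) :* D :* (a :* D)
           := a :* ((b :* D) :* (b :* D) :- (a :* D) :* (a :* D) :* M)) refl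

    collect : ∀ a C D E → a ℚ.* (C ℚ.* C ℚ.- 1ℚ ℚ.* 1ℚ ℚ.* (E ℚ.* D ℚ.+ C ℚ.* C))
            ≡ ℚ.- E ℚ.* (a ℚ.* D)
    collect = solve 4 (λ a C D E →
      a :* (C :* C :- con 1ℚ :* con 1ℚ :* (E :* D :+ C :* C)) := :- E :* (a :* D)) refl

    norm-scaled : norm x ℚ.* ι d ≡ ℚ.- ι e
    norm-scaled = begin
      -- The norm is -e/d. Clearing its denominator d² takes a second factor d, which comes from
      -- inserting a·d = 1.
      norm x ℚ.* ι d                    ≡⟨ ℚₚ.*-identityʳ _ ⟨
      norm x ℚ.* ι d ℚ.* 1ℚ             ≡⟨ cong (norm x ℚ.* ι d ℚ.*_) xi ⟨
      norm x ℚ.* ι d ℚ.* (a ℚ.* ι d)    ≡⟨ expand a b (ι d) (ι (+ N)) ⟩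
      a ℚ.* ((b ℚ.* ι d) ℚ.* (b ℚ.* ι d) ℚ.- (a ℚ.* ι d) ℚ.* (a ℚ.* ι d) ℚ.* ι (+ N))
        ≡⟨ cong₂ (λ p q → a ℚ.* (q ℚ.* q ℚ.- p ℚ.* p ℚ.* ι (+ N))) xi xr ⟩
      a ℚ.* (ι c ℚ.* ι c ℚ.- 1ℚ ℚ.* 1ℚ ℚ.* ι (+ N))
        ≡⟨ cong (λ M → a ℚ.* (ι c ℚ.* ι c ℚ.- 1ℚ ℚ.* 1ℚ ℚ.* M)) N≡ ⟩
      a ℚ.* (ι c ℚ.* ι c ℚ.- 1ℚ ℚ.* 1ℚ ℚ.* (ι e ℚ.* ι d ℚ.+ ι c ℚ.* ι c))
        ≡⟨ collect a (ι c) (ι d) (ι e) ⟩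
      ℚ.- ι e ℚ.* (a ℚ.* ι d)           ≡⟨ cong (ℚ.- ι e ℚ.*_) xi ⟩
      ℚ.- ι e ℚ.* 1ℚ                    ≡⟨ ℚₚ.*-identityʳ _ ⟩
      ℚ.- ι e                           ∎

    norm≢0 : norm x ≢ 0ℚ
    norm≢0 norm≡0 = e≢0 (ι-injective (ℚₚ.neg-injective (begin
      ℚ.- ι e           ≡⟨ norm-scaled ⟨
      norm x ℚ.* ι d    ≡⟨ cong (ℚ._* ι d) norm≡0 ⟩
      0ℚ ℚ.* ι d        ≡⟨ ℚₚ.*-zeroˡ (ι d) ⟩
      0ℚ                ∎)))

    regroup : ∀ p n v D → (p ℚ.* v) ℚ.* (n ℚ.* D) ≡ (p ℚ.* D) ℚ.* (v ℚ.* n)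
    regroup = solve 4 (λ p n v D → (p :* v) :* (n :* D) := (p :* D) :* (v :* n)) refl

    scale : ∀ p v → v ℚ.* norm x ≡ 1ℚ → (p ℚ.* v) ℚ.* ℚ.- ι e ≡ p ℚ.* ι d
    scale p v v-inv = begin
      (p ℚ.* v) ℚ.* ℚ.- ι e             ≡⟨ cong ((p ℚ.* v) ℚ.*_) norm-scaled ⟨
      (p ℚ.* v) ℚ.* (norm x ℚ.* ι d)    ≡⟨ regroup p (norm x) v (ι d) ⟩
      (p ℚ.* ι d) ℚ.* (v ℚ.* norm x)    ≡⟨ cong ((p ℚ.* ι d) ℚ.*_) v-inv ⟩
      (p ℚ.* ι d) ℚ.* 1ℚ                ≡⟨ ℚₚ.*-identityʳ _ ⟩
      p ℚ.* ι d                         ∎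

    move-neg : ∀ a v E → (ℚ.- a ℚ.* v) ℚ.* E ≡ (a ℚ.* v) ℚ.* ℚ.- E
    move-neg = solve 3 (λ a v E → (:- a :* v) :* E := (a :* v) :* :- E) refl

    pull-neg : ∀ b v E → (b ℚ.* v) ℚ.* E ≡ ℚ.- ((b ℚ.* v) ℚ.* ℚ.- E)
    pull-neg = solve 3 (λ b v E → (b :* v) :* E := :- ((b :* v) :* :- E)) refl

    inverse : Surd (x ⁻¹) (ℤ.- c) e
    inverse with norm x ℚ.≟ 0ℚ
    -- A vanishing norm, where `_⁻¹` has its default value 0, would give e = 0.
    ... | yes norm≡0 = contradiction norm≡0 norm≢0
    ... | no ≢0 = surd
      (trans (move-neg a v (ι e)) (trans (scale a v v-inv) xi))
      (begin
        (b ℚ.* v) ℚ.* ι e               ≡⟨ pull-neg b v (ι e) ⟩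
        ℚ.- ((b ℚ.* v) ℚ.* ℚ.- ι e)     ≡⟨ cong ℚ.-_ (scale b v v-inv) ⟩
        ℚ.- (b ℚ.* ι d)                 ≡⟨ cong ℚ.-_ xr ⟩
        ℚ.- ι c                         ≡⟨ ι-neg c ⟨
        ι (ℤ.- c)                       ∎)
      where
      v = ℚ.1/_ (norm x) {{ℚ.≢-nonZero ≢0}}
      v-inv : v ℚ.* norm x ≡ 1ℚ
      v-inv = ℚₚ.*-inverseˡ (norm x) {{ℚ.≢-nonZero ≢0}}

  -- The numerator (√N + c)(√N + k) is (k + c)√N + (N + ck), in general no longer √N plus an
  -- integer, so the two coefficients are stated separately, multiplied by f and d.
  surd-⊗ : ∀ {x z c d k f} → Surd x c d → Surd z k f →
           (ℚ√.irr (x ⊗ z) ℚ.* ι f) ℚ.* ι d ≡ ι (k ℤ.+ c) ×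
           (ℚ√.rat (x ⊗ z) ℚ.* ι f) ℚ.* ι d ≡ ι (+ N ℤ.+ c ℤ.* k)
  surd-⊗ {⟨ a , b ⟩} {⟨ a′ , b′ ⟩} {c} {d} {k} {f} (surd xi xr) (surd zi zr) =
    (begin
      ((a ℚ.* b′ ℚ.+ b ℚ.* a′) ℚ.* ι f) ℚ.* ι d     ≡⟨ irr-expand a b a′ b′ (ι d) (ι f) ⟩
      (a ℚ.* ι d) ℚ.* (b′ ℚ.* ι f) ℚ.+ (b ℚ.* ι d) ℚ.* (a′ ℚ.* ι f)
        ≡⟨ cong₂ ℚ._+_ (cong₂ ℚ._*_ xi zr) (cong₂ ℚ._*_ xr zi) ⟩
      1ℚ ℚ.* ι k ℚ.+ ι c ℚ.* 1ℚ                     ≡⟨ cong₂ ℚ._+_ (ℚₚ.*-identityˡ (ι k)) (ℚₚ.*-identityʳ (ι c)) ⟩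
      ι k ℚ.+ ι c                                   ≡⟨ ι-+ k c ⟨
      ι (k ℤ.+ c)                                   ∎) ,
    (begin
      ((a ℚ.* a′ ℚ.* M ℚ.+ b ℚ.* b′) ℚ.* ι f) ℚ.* ι d    ≡⟨ rat-expand a b a′ b′ (ι d) (ι f) M ⟩
      (a ℚ.* ι d) ℚ.* (a′ ℚ.* ι f) ℚ.* M ℚ.+ (b ℚ.* ι d) ℚ.* (b′ ℚ.* ι f)
        ≡⟨ cong₂ ℚ._+_ (cong₂ (λ p q → p ℚ.* q ℚ.* M) xi zi) (cong₂ ℚ._*_ xr zr) ⟩
      1ℚ ℚ.* 1ℚ ℚ.* M ℚ.+ ι c ℚ.* ι k               ≡⟨ cong₂ ℚ._+_ (ℚₚ.*-identityˡ M) (sym (ι-* c k)) ⟩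
      M ℚ.+ ι (c ℤ.* k)                             ≡⟨ ι-+ (+ N) (c ℤ.* k) ⟨
      ι (+ N ℤ.+ c ℤ.* k)                           ∎)
    where
    M = ι (+ N)
    irr-expand : ∀ a b a′ b′ D F → ((a ℚ.* b′ ℚ.+ b ℚ.* a′) ℚ.* F) ℚ.* D
               ≡ (a ℚ.* D) ℚ.* (b′ ℚ.* F) ℚ.+ (b ℚ.* D) ℚ.* (a′ ℚ.* F)
    irr-expand = solve 6 (λ a b a′ b′ D F → ((a :* b′ :+ b :* a′) :* F) :* D
               := (a :* D) :* (b′ :* F) :+ (b :* D) :* (a′ :* F)) refl
    rat-expand : ∀ a b a′ b′ D F M → ((a ℚ.* a′ ℚ.* M ℚ.+ b ℚ.* b′) ℚ.* F) ℚ.* D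
               ≡ (a ℚ.* D) ℚ.* (a′ ℚ.* F) ℚ.* M ℚ.+ (b ℚ.* D) ℚ.* (b′ ℚ.* F)
    rat-expand = solve 7 (λ a b a′ b′ D F M → ((a :* a′ :* M :+ b :* b′) :* F) :* D
               := (a :* D) :* (a′ :* F) :* M :+ (b :* D) :* (b′ :* F)) refl

  -- Here x + 1 = (√N + c + d)/d has inverse (√N - c - d)/f, and the product with x is (-d√N + d(e -
  -- c))/(df), where d cancels.
  surd-left-child : ∀ {x c d} e → let f = e ℤ.- c ℤ.- c ℤ.- d in
    f ≢ 0ℤ → + N ≡ e ℤ.* d ℤ.+ c ℤ.* c →
    Surd x c d → Surd (x ⊗ (x ⊕ fromℤ 1ℤ) ⁻¹) (c ℤ.- e) (ℤ.- f)
  surd-left-child {x} {c} {d} e f≢0 N-eq sx@(surd xi _) = surd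
    (cancel-unit {p ℚ.* ι (ℤ.- f)} {1ℚ} {ℚ√.irr x} xi (begin
      (p ℚ.* ι (ℤ.- f)) ℚ.* ι d           ≡⟨ pull p ⟩
      ℚ.- ((p ℚ.* ι f) ℚ.* ι d)           ≡⟨ cong ℚ.-_ (proj₁ product) ⟩
      ℚ.- ι (ℤ.- c₁ ℤ.+ c)                ≡⟨ ι-neg (ℤ.- c₁ ℤ.+ c) ⟨
      ι (ℤ.- (ℤ.- c₁ ℤ.+ c))              ≡⟨ cong ι (irr-eq c d) ⟩
      ι d                                 ≡⟨ ℚₚ.*-identityˡ (ι d) ⟨
      1ℚ ℚ.* ι d                          ∎))
    (cancel-unit {s ℚ.* ι (ℤ.- f)} {ι (c ℤ.- e)} {ℚ√.irr x} xi (begin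
      (s ℚ.* ι (ℤ.- f)) ℚ.* ι d           ≡⟨ pull s ⟩
      ℚ.- ((s ℚ.* ι f) ℚ.* ι d)           ≡⟨ cong ℚ.-_ (proj₂ product) ⟩
      ℚ.- ι (+ N ℤ.+ c ℤ.* ℤ.- c₁)        ≡⟨ ι-neg (+ N ℤ.+ c ℤ.* ℤ.- c₁) ⟨
      ι (ℤ.- (+ N ℤ.+ c ℤ.* ℤ.- c₁))      ≡⟨ cong (λ n → ι (ℤ.- (n ℤ.+ c ℤ.* ℤ.- c₁))) N-eq ⟩
      ι (ℤ.- (e ℤ.* d ℤ.+ c ℤ.* c ℤ.+ c ℤ.* ℤ.- c₁))    ≡⟨ cong ι (rat-eq c d e) ⟩
      ι ((c ℤ.- e) ℤ.* d)                 ≡⟨ ι-* (c ℤ.- e) d ⟩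
      ι (c ℤ.- e) ℚ.* ι d                 ∎))
    where
    f = e ℤ.- c ℤ.- c ℤ.- d
    c₁ = c ℤ.+ 1ℤ ℤ.* d
    z = (x ⊕ fromℤ 1ℤ) ⁻¹
    p = ℚ√.irr (x ⊗ z)
    s = ℚ√.rat (x ⊗ z)

    shifted-eq : ∀ c d e → e ℤ.* d ℤ.+ c ℤ.* c
      ≡ (e ℤ.- c ℤ.- c ℤ.- d) ℤ.* d ℤ.+ (c ℤ.+ 1ℤ ℤ.* d) ℤ.* (c ℤ.+ 1ℤ ℤ.* d)
    shifted-eq = solve-∀

    irr-eq : ∀ c d → ℤ.- (ℤ.- (c ℤ.+ 1ℤ ℤ.* d) ℤ.+ c) ≡ d
    irr-eq = solve-∀

    rat-eq : ∀ c d e →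
      ℤ.- (e ℤ.* d ℤ.+ c ℤ.* c ℤ.+ c ℤ.* ℤ.- (c ℤ.+ 1ℤ ℤ.* d)) ≡ (c ℤ.- e) ℤ.* d
    rat-eq = solve-∀

    product = surd-⊗ sx
      (surd-⁻¹ f f≢0 (trans N-eq (shifted-eq c d e)) (surd-⊕ sx 1ℤ))

    pull-neg : ∀ p F D → (p ℚ.* ℚ.- F) ℚ.* D ≡ ℚ.- ((p ℚ.* F) ℚ.* D)
    pull-neg = solve 3 (λ p F D → (p :* :- F) :* D := :- ((p :* F) :* D)) refl

    pull : ∀ p → (p ℚ.* ι (ℤ.- f)) ℚ.* ι d ≡ ℚ.- ((p ℚ.* ι f) ℚ.* ι d)
    pull p = trans (cong (λ F → (p ℚ.* F) ℚ.* ι d) (ι-neg f)) (pull-neg p (ι f) (ι d))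

  -- Signs of surds as integer inequalities.

  nonNeg-surd : ∀ {x c d} → 0ℤ ℤ.< d → Surd x c d → NonNeg x →
                0ℤ ℤ.≤ c ⊎ c ℤ.* c ℤ.≤ + N
  nonNeg-surd {⟨ a , b ⟩} {c} {d} 0<d (surd xi xr) = λ where
      (inj₁ (_ , 0≤b))               → inj₁ (0≤c 0≤b)
      (inj₂ (inj₁ (_ , _ , b²≤a²N))) → inj₂ (ι-cancel-≤
        (subst₂ ℚ._≤_ (rat²-scaled b {c} {d} xr) (irr²-scaled a (ι (+ N)) {d} xi)
          (scale-≤ {d ℤ.* d} (b ℚ.* b) (a ℚ.* a ℚ.* ι (+ N)) (0≤square d) b²≤a²N)))
      (inj₂ (inj₂ (_ , 0≤b , _)))    → inj₁ (0≤c 0≤b)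
    where
    0≤c : 0ℚ ℚ.≤ b → 0ℤ ℤ.≤ c
    0≤c 0≤b = ι-cancel-≤ (subst (0ℚ ℚ.≤_) xr (scale-0≤ (ℤₚ.<⇒≤ 0<d) 0≤b))

  -- The negative denominator forces √N + c ≤ 0, that is -c ≥ √N. The cases of `NonNeg` with 0 ≤ a
  -- are impossible because a·d = -1.
  nonNeg-neg-surd : ∀ {x c d} → 0ℤ ℤ.< d → Surd x c (ℤ.- d) → NonNeg x →
                    c ℤ.≤ 0ℤ × + N ℤ.≤ c ℤ.* c
  nonNeg-neg-surd {⟨ a , b ⟩} {c} {d} 0<d (surd xi xr) = λ where
      (inj₁ (0≤a , _))                 → contradiction 0≤a 0≰a
      (inj₂ (inj₁ (0≤a , _)))          → contradiction 0≤a 0≰a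
      (inj₂ (inj₂ (_ , 0≤b , a²N≤b²))) →
        ℤₚ.neg-cancel-≤ (ι-cancel-≤ (subst (0ℚ ℚ.≤_)
          (trans (scaled-neg b (ι c) xr) (sym (ι-neg c))) (scale-0≤ (ℤₚ.<⇒≤ 0<d) 0≤b))) ,
        ι-cancel-≤ (subst₂ ℚ._≤_ (irr²-scaled a (ι (+ N)) {ℤ.- d} xi) (rat²-scaled b {c} {ℤ.- d} xr)
          (scale-≤ {ℤ.- d ℤ.* ℤ.- d} (a ℚ.* a ℚ.* ι (+ N)) (b ℚ.* b) (0≤square (ℤ.- d)) a²N≤b²))
    where
    scaled-neg : ∀ p q → p ℚ.* ι (ℤ.- d) ≡ q → p ℚ.* ι d ≡ ℚ.- q
    scaled-neg p q eq = begin
      p ℚ.* ι d                  ≡⟨ double-neg p (ι d) ⟩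
      ℚ.- (p ℚ.* ℚ.- ι d)        ≡⟨ cong (λ D → ℚ.- (p ℚ.* D)) (ι-neg d) ⟨
      ℚ.- (p ℚ.* ι (ℤ.- d))      ≡⟨ cong ℚ.-_ eq ⟩
      ℚ.- q                      ∎
      where
      double-neg : ∀ p D → p ℚ.* D ≡ ℚ.- (p ℚ.* ℚ.- D)
      double-neg = solve 2 (λ p D → p :* D := :- (p :* :- D)) refl

    0≰a : ¬ 0ℚ ℚ.≤ a
    0≰a 0≤a = 0≰-1 (subst (0ℚ ℚ.≤_) (scaled-neg a 1ℚ xi) (scale-0≤ (ℤₚ.<⇒≤ 0<d) 0≤a))

  surd-from-⊖ : ∀ {x c d} → Surd x c d → ∀ m → Surd (fromℤ m ⊖ x) (c ℤ.- m ℤ.* d) (ℤ.- d)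
  surd-from-⊖ {x@(⟨ a , b ⟩)} {c} {d} sx m =
    subst (λ y → Surd y (c ℤ.- m ℤ.* d) (ℤ.- d))
      (cong₂ ⟨_,_⟩ (flip a 0ℚ) (flip b (ι m))) (surd-⊝ (surd-⊖ sx m))
    where
    flip : ∀ p q → ℚ.- (p ℚ.- q) ≡ q ℚ.- p
    flip = solve 2 (λ p q → :- (p :- q) := q :- p) refl

-- Integer inequalities and uniqueness of the integer part.

square-mono : ∀ {i j} → 0ℤ ℤ.≤ i → i ℤ.≤ j → i ℤ.* i ℤ.≤ j ℤ.* j
square-mono {i} {j} 0≤i i≤j = ℤₚ.≤-trans
  (ℤₚ.*-monoˡ-≤-nonNeg i {{ℤ.nonNegative 0≤i}} i≤j)
  (ℤₚ.*-monoʳ-≤-nonNeg j {{ℤ.nonNegative (ℤₚ.≤-trans 0≤i i≤j)}} i≤j)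

square-antimono : ∀ {i j} → j ℤ.≤ 0ℤ → i ℤ.≤ j → j ℤ.* j ℤ.≤ i ℤ.* i
square-antimono {i} {j} j≤0 i≤j =
  subst₂ ℤ._≤_ (square-neg j) (square-neg i) (square-mono (ℤₚ.neg-mono-≤ j≤0) (ℤₚ.neg-mono-≤ i≤j))
  where
  square-neg : ∀ k → ℤ.- k ℤ.* ℤ.- k ≡ k ℤ.* k
  square-neg = solve-∀

0<-* : ∀ {i j} → 0ℤ ℤ.< i → 0ℤ ℤ.< j → 0ℤ ℤ.< i ℤ.* j
0<-* {i} {j} 0<i 0<j =
  subst (ℤ._< i ℤ.* j) (ℤₚ.*-zeroˡ j) (ℤₚ.*-monoʳ-<-pos j {{ℤ.positive 0<j}} 0<i)

0<-*-cancelʳ : ∀ {i j} → 0ℤ ℤ.< j → 0ℤ ℤ.< i ℤ.* j → 0ℤ ℤ.< i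
0<-*-cancelʳ {i} {j} 0<j 0<ij = ℤₚ.*-cancelʳ-<-nonNeg j {{ℤ.nonNegative (ℤₚ.<⇒≤ 0<j)}}
  (subst (ℤ._< i ℤ.* j) (sym (ℤₚ.*-zeroˡ j)) 0<ij)

<-from-+ : ∀ {i j k} → 0ℤ ℤ.< k → j ≡ k ℤ.+ i → i ℤ.< j
<-from-+ {i} {j} {k} 0<k eq =
  subst₂ ℤ._<_ (ℤₚ.+-identityˡ i) (sym eq) (ℤₚ.+-monoˡ-< i 0<k)

≤-from-* : ∀ {i j k d} → 0ℤ ℤ.≤ d → k ℤ.≤ 0ℤ → i ≡ k ℤ.* d ℤ.+ j → i ℤ.≤ j
≤-from-* {i} {j} {k} {d} 0≤d k≤0 eq =
  subst₂ ℤ._≤_ (sym eq) (ℤₚ.+-identityˡ j)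
    (ℤₚ.+-monoˡ-≤ j (subst (k ℤ.* d ℤ.≤_) (ℤₚ.*-zeroˡ d)
      (ℤₚ.*-monoʳ-≤-nonNeg d {{ℤ.nonNegative 0≤d}} k≤0)))

-- The hypotheses say 0 < (√N + c)/d < 1.
floor-unique : ∀ {N} {x : ℚ√ N} c d t m → 0ℤ ℤ.< d →
  c ℤ.* c ℤ.< + N → + N ℤ.< (c ℤ.- d) ℤ.* (c ℤ.- d) →
  Surd x (c ℤ.+ t ℤ.* d) d → IsFloor x m → m ≡ t
floor-unique {N} {x} c d t m 0<d c²<N N<[c-d]² sx (m≼x , (x≼m+1 , _)) with ℤₚ.<-cmp m t
... | tri≈ _ m≡t _ = m≡t
-- If m > t, then x - m is at most (√N + c)/d - 1 < 0.
... | tri> _ _ t<m = contradiction (nonNeg-surd 0<d (surd-⊖ sx m) m≼x) λ where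
    (inj₁ 0≤c′)  → ℤₚ.<⇒≱ c-d<0 (ℤₚ.≤-trans 0≤c′ c′≤c-d)
    (inj₂ c′²≤N) → ℤₚ.<⇒≱ N<[c-d]² (ℤₚ.≤-trans (square-antimono (ℤₚ.<⇒≤ c-d<0) c′≤c-d) c′²≤N)
  where
  c-d<0 : c ℤ.- d ℤ.< 0ℤ
  -- Squares alone leave the sign of c - d open; 0 ≤ c - d ≤ c would give (c - d)² ≤ c² < N.
  c-d<0 = ℤₚ.≰⇒> λ 0≤c-d → ℤₚ.<⇒≱ (ℤₚ.<-trans c²<N N<[c-d]²)
    (square-mono {c ℤ.- d} {c} 0≤c-d (ℤₚ.i≤j⇒i-k≤j d {{ℤ.nonNegative (ℤₚ.<⇒≤ 0<d)}} ℤₚ.≤-refl))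

  eq : ∀ c d t m → c ℤ.+ t ℤ.* d ℤ.- m ℤ.* d ≡ (1ℤ ℤ.+ t ℤ.- m) ℤ.* d ℤ.+ (c ℤ.- d)
  eq = solve-∀

  c′≤c-d : c ℤ.+ t ℤ.* d ℤ.- m ℤ.* d ℤ.≤ c ℤ.- d
  c′≤c-d = ≤-from-* (ℤₚ.<⇒≤ 0<d) (ℤₚ.i≤j⇒i-j≤0 (ℤₚ.i<j⇒suc[i]≤j t<m)) (eq c d t m)
-- If m < t, then m + 1 - x is at most -(√N + c)/d < 0.
... | tri< m<t _ _ =
  let c′≤0 , N≤c′² = nonNeg-neg-surd 0<d (surd-from-⊖ sx (m ℤ.+ 1ℤ)) x≼m+1
  in contradiction (ℤₚ.≤-trans N≤c′² (square-antimono c′≤0 c≤c′)) (ℤₚ.<⇒≱ c²<N)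
  where
  eq : ∀ c d t m →
    c ≡ (1ℤ ℤ.+ m ℤ.- t) ℤ.* d ℤ.+ (c ℤ.+ t ℤ.* d ℤ.- (m ℤ.+ 1ℤ) ℤ.* d)
  eq = solve-∀

  c≤c′ : c ℤ.≤ c ℤ.+ t ℤ.* d ℤ.- (m ℤ.+ 1ℤ) ℤ.* d
  c≤c′ = ≤-from-* (ℤₚ.<⇒≤ 0<d) (ℤₚ.i≤j⇒i-j≤0 (ℤₚ.i<j⇒suc[i]≤j m<t)) (eq c d t m)

-- The two mutually inverse surds attached to a triple.

opposite : Direction → Direction
opposite r = ℓ
opposite ℓ = r

-- For a vertex x = (√N + c)/d of the path these are the numerator and
-- denominator of the positive surd −x* = (√N − c)/d (direction r) or of its
-- inverse −1/x* = (√N + c)/e (direction ℓ).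
num den : ∀ {N} → Direction → Triple N → ℤ
num r t = ℤ.- Triple.c t
num ℓ t = Triple.c t
den r t = Triple.d t
den ℓ t = Triple.e t

module _ {N : ℕ} where

  num-opposite : ∀ δ (t : Triple N) → num (opposite δ) t ≡ ℤ.- num δ t
  num-opposite r t = sym (ℤₚ.neg-involutive (Triple.c t))
  num-opposite ℓ t = refl

  -- Negating c while exchanging d and e preserves N = ed + c². By this relation the inverse of the
  -- surd for δ has denominator `den (opposite δ)`, as `surd-⁻¹` requires.
  num-den : ∀ δ (t : Triple N) →
    + N ≡ den (opposite δ) t ℤ.* den δ t ℤ.+ num δ t ℤ.* num δ t
  num-den r t = trans (Triple.N-eq t) (eq (Triple.c t) (Triple.d t) (Triple.e t))
    where
    eq : ∀ c d e → e ℤ.* d ℤ.+ c ℤ.* c ≡ e ℤ.* d ℤ.+ ℤ.- c ℤ.* ℤ.- c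
    eq = solve-∀
  num-den ℓ t = trans (Triple.N-eq t) (cong (ℤ._+ c ℤ.* c) (ℤₚ.*-comm (Triple.e t) (Triple.d t)))
    where c = Triple.c t

  den-pos : ∀ δ (t : Triple N) → 0ℤ ℤ.< Triple.e t → 0ℤ ℤ.< den δ t
  den-pos r t _   = Triple.d>0 t
  den-pos ℓ t 0<e = 0<e

  num²<N : ∀ δ (t : Triple N) → 0ℤ ℤ.< Triple.e t → num δ t ℤ.* num δ t ℤ.< + N
  num²<N δ t 0<e =
    <-from-+ (0<-* (den-pos (opposite δ) t 0<e) (den-pos δ t 0<e)) (num-den δ t)

  -- The case of `leftTriple` where ε is kept, given by equations on the components. The sign of f
  -- is read off from the child's positive denominator -f.
  record KeepsSign (t l : Triple N) : Set where
    private module t = Triple t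
    private module l = Triple l
    field
      ε≡  : l.ε ≡ t.ε
      c≡  : l.c ≡ t.c ℤ.- t.e
      d≡  : l.d ≡ ℤ.- t.f
      e≡  : l.e ≡ t.e

    f<0 : t.f ℤ.< 0ℤ
    f<0 = ℤₚ.neg-cancel-< (subst (0ℤ ℤ.<_) d≡ l.d>0)

-- Steps of the path and their effect on the surds.

module Walk {N : ℕ} (nonSquare : NonSquare N) (t₀ : Triple N) (α : ℚ√ N) where

  private
    T : Vertex → Triple N
    T = triple nonSquare t₀

    turn : Vertex → Direction
    turn = step nonSquare t₀

  leftTriple-cases : ∀ t → let l = leftTriple nonSquare t in
    (Triple.ε l ≡ Sign.opposite (Triple.ε t) × Triple.d l ≡ Triple.f t)
    ⊎ KeepsSign t l
  leftTriple-cases t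
    with 0ℤ ℤ.<? + N ℤ.- (Triple.c t ℤ.+ Triple.d t) ℤ.* (Triple.c t ℤ.+ Triple.d t)
  ... | yes _ = inj₁ (refl , refl)
  ... | no _  = inj₂ (record { ε≡ = refl ; c≡ = refl ; d≡ = refl ; e≡ = refl })

  -- On the path the left child has ε = 1 exactly when f < 0. Hence a right step records (c + d)² <
  -- N, which there means -x* > 1, and a left step the reverse inequality.
  data Move (v : Vertex) : Direction → Set where
    right : 0ℤ ℤ.< Triple.f (T v) → Move v r
    left  : KeepsSign (T v) (T (child ℓ v)) → Move v ℓ

  -- The invariant of the path. `0<e` encodes c² < N, which together with d > 0 makes both x and -x*
  -- positive.
  record OnPath (v : Vertex) : Set where
    field
      ε≡+   : Triple.ε (T v) ≡ Sign.+
      0<e   : 0ℤ ℤ.< Triple.e (T v)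
      value : Surd (label α v) (Triple.c (T v)) (Triple.d (T v))

  turn-ℓ : ∀ v → Triple.ε (T (child ℓ v)) ≡ Sign.+ → turn v ≡ ℓ
  turn-ℓ v eq with Sign.+ ← Triple.ε (T (child ℓ v)) | refl ← eq = refl

  turn-r : ∀ v → Triple.ε (T (child ℓ v)) ≡ Sign.- → turn v ≡ r
  turn-r v eq with Sign.- ← Triple.ε (T (child ℓ v)) | refl ← eq = refl

  move : ∀ v → OnPath v → Move v (turn v)
  move v on with leftTriple-cases (T v)
  ... | inj₁ (ε≡ , d≡) =
    subst (Move v) (sym (turn-r v (trans ε≡ (cong Sign.opposite (OnPath.ε≡+ on)))))
      (right (subst (0ℤ ℤ.<_) d≡ (Triple.d>0 (leftTriple nonSquare (T v)))))
  ... | inj₂ keeps =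
    subst (Move v) (sym (turn-ℓ v (trans (KeepsSign.ε≡ keeps) (OnPath.ε≡+ on)))) (left keeps)

  -- After a right step the new e is f, positive by the move; after a left step e is unchanged.
  onPath-child : ∀ {v δ} → OnPath v → Move v δ → OnPath (child δ v)
  onPath-child {v} on (right 0<f) = record
    { ε≡+   = OnPath.ε≡+ on
    ; 0<e   = 0<f
    ; value = surd-resp (cong (λ k → c ℤ.+ k) (ℤₚ.*-identityˡ d)) refl (surd-⊕ (OnPath.value on) 1ℤ)
    }
    where open Triple (T v)
  onPath-child {v} on (left k) = record
    { ε≡+   = trans ε≡ (OnPath.ε≡+ on)
    ; 0<e   = subst (0ℤ ℤ.<_) (sym e≡) (OnPath.0<e on)
    ; value = surd-resp (sym c≡) (sym d≡)
                (surd-left-child (Triple.e (T v)) (ℤₚ.<⇒≢ f<0) (Triple.N-eq (T v)) (OnPath.value on))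
    }
    where open KeepsSign k

  -- Together with `den-child`: a step in direction δ subtracts 1 from the surd (√N + num)/den of
  -- that direction.
  num-child : ∀ {v δ} → Move v δ → num δ (T v) ≡ num δ (T (child δ v)) ℤ.+ den δ (T v)
  num-child {v} (right _) = eq c d
    where
    open Triple (T v)
    eq : ∀ c d → ℤ.- c ≡ ℤ.- (c ℤ.+ d) ℤ.+ d
    eq = solve-∀
  num-child {v} (left k) = trans (eq c e) (cong (ℤ._+ e) (sym (KeepsSign.c≡ k)))
    where
    open Triple (T v)
    eq : ∀ c e → c ≡ c ℤ.- e ℤ.+ e
    eq = solve-∀

  den-child : ∀ {v δ} → Move v δ → den δ (T (child δ v)) ≡ den δ (T v)
  den-child (right _) = refl
  den-child (left k)  = KeepsSign.e≡ k

  -- The difference (num - den)² - N is -f·d for `r` and f·e for `ℓ`, and the opposite move gives f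
  -- the matching sign. This supplies the upper bound 1 in `floor-unique`.
  N<[num-den]² : ∀ {v} δ → OnPath v → Move v (opposite δ) →
    let a = num δ (T v) ℤ.- den δ (T v) in + N ℤ.< a ℤ.* a
  N<[num-den]² {v} r _ (left k) =
    <-from-+ (0<-* (ℤₚ.neg-mono-< f<0) d>0)
      (trans (eq c d e) (cong (λ n → ℤ.- f ℤ.* d ℤ.+ n) (sym N-eq)))
    where
    open Triple (T v)
    open KeepsSign k using (f<0)
    eq : ∀ c d e → (ℤ.- c ℤ.- d) ℤ.* (ℤ.- c ℤ.- d)
       ≡ ℤ.- (e ℤ.- c ℤ.- c ℤ.- d) ℤ.* d ℤ.+ (e ℤ.* d ℤ.+ c ℤ.* c)
    eq = solve-∀
  N<[num-den]² {v} ℓ on (right 0<f) =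
    <-from-+ (0<-* 0<f (OnPath.0<e on)) (trans (eq c d e) (cong (λ n → f ℤ.* e ℤ.+ n) (sym N-eq)))
    where
    open Triple (T v)
    eq : ∀ c d e → (c ℤ.- e) ℤ.* (c ℤ.- e)
       ≡ (e ℤ.- c ℤ.- c ℤ.- d) ℤ.* e ℤ.+ (e ℤ.* d ℤ.+ c ℤ.* c)
    eq = solve-∀

  module _ (root-onPath : OnPath root) where

    private
      P : ℕ → Vertex
      P = lpp nonSquare t₀

    onPath : ∀ n → OnPath (P n)
    onPath zero    = root-onPath
    onPath (suc n) = onPath-child (onPath n) (move (P n) (onPath n))

    -- The number z stays fixed while the vertex moves: each of the j steps takes 1 off the surd of
    -- the vertex, and the summand j·den puts it back.
    surd-run : ∀ {δ} {z : ℚ√ N} k j → (∀ i → i < j → turn (P (k ℕ.+ i)) ≡ δ) →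
      Surd z (num δ (T (P k))) (den δ (T (P k))) →
      let t = T (P (k ℕ.+ j)) in Surd z (num δ t ℤ.+ + j ℤ.* den δ t) (den δ t)
    surd-run {δ} {z} k zero _ sz =
      subst (λ i → let t = T (P i) in Surd z (num δ t ℤ.+ 0ℤ ℤ.* den δ t) (den δ t))
        (sym (ℕₚ.+-identityʳ k)) (surd-resp (sym (eq (num δ (T (P k))) (den δ (T (P k))))) refl sz)
      where
      eq : ∀ c d → c ℤ.+ 0ℤ ℤ.* d ≡ c
      eq = solve-∀
    surd-run {δ} {z} k (suc j) straight sz rewrite ℕₚ.+-suc k j =
      next (P (k ℕ.+ j)) (straight j (ℕₚ.n<1+n j)) (move (P (k ℕ.+ j)) (onPath (k ℕ.+ j)))
        (surd-run k j (λ i i<j → straight i (ℕₚ.<-trans i<j (ℕₚ.n<1+n j))) sz)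
      where
      eq : ∀ c d m → c ℤ.+ d ℤ.+ m ℤ.* d ≡ c ℤ.+ (1ℤ ℤ.+ m) ℤ.* d
      eq = solve-∀

      next : ∀ v {δ′} → δ′ ≡ δ → Move v δ′ →
        Surd z (num δ (T v) ℤ.+ + j ℤ.* den δ (T v)) (den δ (T v)) →
        let t = T (child δ′ v) in Surd z (num δ t ℤ.+ + suc j ℤ.* den δ t) (den δ t)
      next v refl m = surd-resp
        (begin
          num δ (T v) ℤ.+ + j ℤ.* den δ (T v)
            ≡⟨ cong (λ c → c ℤ.+ + j ℤ.* den δ (T v)) (num-child m) ⟩
          num δ t ℤ.+ den δ (T v) ℤ.+ + j ℤ.* den δ (T v)
            ≡⟨ cong (λ d → num δ t ℤ.+ d ℤ.+ + j ℤ.* d) (den-child m) ⟨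
          num δ t ℤ.+ den δ t ℤ.+ + j ℤ.* den δ t
            ≡⟨ eq (num δ t) (den δ t) (+ j) ⟩
          num δ t ℤ.+ + suc j ℤ.* den δ t ∎)
        (sym (den-child m))
        where t = T (child δ v)

-- Blocks between direction changes, and their parity.

≢⇒opposite : ∀ {δ δ′} → δ′ ≢ δ → δ ≡ opposite δ′
≢⇒opposite {ℓ} {ℓ} neq = contradiction refl neq
≢⇒opposite {ℓ} {r} neq = refl
≢⇒opposite {r} {ℓ} neq = refl
≢⇒opposite {r} {r} neq = contradiction refl neq

infix 4 _≟ᵈ_
_≟ᵈ_ : (δ δ′ : Direction) → Dec (δ ≡ δ′)
ℓ ≟ᵈ ℓ = yes refl
ℓ ≟ᵈ r = no λ ()
r ≟ᵈ ℓ = no λ ()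
r ≟ᵈ r = yes refl

module _ {s : ℕ → Direction} {φ : ℕ → ℕ} (changes : IsDirectionChanges s φ) where

  open IsDirectionChanges changes

  -- A change strictly inside the block would be an index above φ n and below φ (suc n), against
  -- `φ-least`.
  constant-run : ∀ n j → φ n ℕ.+ j < φ (suc n) → s (φ n ℕ.+ j) ≡ s (φ n)
  constant-run n zero    _ = cong s (ℕₚ.+-identityʳ (φ n))
  constant-run n (suc j) lt rewrite ℕₚ.+-suc (φ n) j
    with s (φ n ℕ.+ j) ≟ᵈ s (suc (φ n ℕ.+ j))
  ... | yes same = trans (sym same) (constant-run n j (ℕₚ.<-trans (ℕₚ.n<1+n _) lt))
  ... | no turns = contradiction (φ-least n _ (s≤s (ℕₚ.m≤m+n (φ n) j)) turns) (ℕₚ.<⇒≱ lt)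

  -- The index just before φ (suc n) still lies in the block starting at φ n, and the change at φ
  -- (suc n) leaves only the other direction.
  alternation : ∀ n → s (φ (suc n)) ≡ opposite (s (φ n))
  alternation n = trans (≢⇒opposite (φ-change n)) (cong opposite
    (trans (cong s (sym last≡)) (constant-run n (last ∸ φ n) (subst (_< φ (suc n)) (sym last≡) last<))))
    where
    last : ℕ
    last = φ (suc n) ∸ 1

    last≡ : φ n ℕ.+ (last ∸ φ n) ≡ last
    last≡ = ℕₚ.m+[n∸m]≡n (ℕₚ.<⇒≤pred (φ-< n))

    last< : last < φ (suc n)
    -- Being above φ n, the index φ (suc n) is positive, so the truncated predecessor is a true one.
    last< = ℕₚ.≤-reflexive (ℕₚ.suc-pred (φ (suc n)) {{ℕ.>-nonZero (ℕₚ.≤-<-trans z≤n (φ-< n))}})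

-- Parity is recorded as the direction of the n-th block of the path, whose first block goes right.
parity : ℕ → Direction
parity zero          = r
parity (suc zero)    = ℓ
parity (suc (suc n)) = parity n

parity-suc : ∀ n → parity (suc n) ≡ opposite (parity n)
parity-suc zero          = refl
parity-suc (suc zero)    = refl
parity-suc (suc (suc n)) = parity-suc n

parity-even : ∀ n → 2 ∣ n → parity n ≡ r
parity-even zero          _   = refl
parity-even (suc zero)    2∣1 = contradiction (ℕ∣.∣⇒≤ 2∣1) λ { (s≤s ()) }
parity-even (suc (suc n)) 2∣n = parity-even n (ℕ∣.∣m+n∣m⇒∣n 2∣n ℕ∣.∣-refl)

parity-odd : ∀ n → ¬ 2 ∣ n → parity n ≡ ℓ
parity-odd zero          2∤0 = contradiction (ℕ∣._∣0 2) 2∤0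
parity-odd (suc zero)    _   = refl
parity-odd (suc (suc n)) 2∤n = parity-odd n λ 2∣n → 2∤n (ℕ∣.∣m∣n⇒∣m+n ℕ∣.∣-refl 2∣n)

-- The root and its first step.

surd-√/ : ∀ {N} q .{{_ : NonZero q}} → Surd (√ N / q) 0ℤ (+ q)
surd-√/ (suc k) = surd
  (ℚₚ.toℚᵘ-injective (ℚᵘₚ.≃-trans (ℚₚ.toℚᵘ-homo-* (+ 1 ℚ./ suc k) (ι (+ suc k)))
    (ℚᵘₚ.≃-trans (ℚᵘₚ.*-cong (ℚₚ.toℚᵘ-fromℚᵘ (ℚᵘ.mkℚᵘ (+ 1) k)) (toℚᵘ-ι (+ suc k)))
      (ℚᵘₚ.*-inverseˡ (ℚᵘ.mkℚᵘ (+ suc k) 0)))))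
  (ℚₚ.*-zeroˡ (ι (+ suc k)))

module _ {N : ℕ} where

  -- `rootTriple` matches q as a successor; these equations give its components for a variable q.
  root-ε : ∀ q .{{_ : NonZero q}} (q∣N : q ∣ N) → Triple.ε (rootTriple q q∣N) ≡ Sign.+
  root-ε (suc _) _ = refl

  root-c : ∀ q .{{_ : NonZero q}} (q∣N : q ∣ N) → Triple.c (rootTriple q q∣N) ≡ 0ℤ
  root-c (suc _) _ = refl

  root-d : ∀ q .{{_ : NonZero q}} (q∣N : q ∣ N) → Triple.d (rootTriple q q∣N) ≡ + q
  root-d (suc _) _ = refl

module Root {N : ℕ} (nonSquare : NonSquare N)
            (q : ℕ) .{{_ : NonZero q}} (q∣N : q ∣ N) (q²<N : q * q < N) where

  open Walk nonSquare (rootTriple q q∣N) (√ N / q) public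

  private
    t₀ : Triple N
    t₀ = rootTriple q q∣N

  root-onPath : OnPath root
  root-onPath = record
    { ε≡+   = root-ε q q∣N
    ; 0<e   = 0<-*-cancelʳ (Triple.d>0 t₀) (subst (0ℤ ℤ.<_) N≡ed 0<N)
    ; value = subst₂ (Surd (√ N / q)) (sym (root-c q q∣N)) (sym (root-d q q∣N)) (surd-√/ q)
    }
    where
    0<N : 0ℤ ℤ.< + N
    0<N = ℤ.+<+ (ℕₚ.≤-<-trans z≤n q²<N)

    N≡ed : + N ≡ Triple.e t₀ ℤ.* Triple.d t₀
    N≡ed = trans (Triple.N-eq t₀) (trans
      (cong (λ c → Triple.e t₀ ℤ.* Triple.d t₀ ℤ.+ c ℤ.* c) (root-c q q∣N)) (ℤₚ.+-identityʳ _))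

  path : ℕ → Vertex
  path = LPP.path nonSquare q q∣N

  s : ℕ → Direction
  s = LPP.s nonSquare q q∣N

  onLPP : ∀ n → OnPath (path n)
  onLPP = onPath root-onPath

  -- At the root f·q = N - q², so q² < N, that is α > 1, makes f positive, whereas a left move has f
  -- < 0.
  starts-right : s 0 ≡ r
  starts-right = move-right (move root root-onPath)
    where
    0<N-q² : 0ℤ ℤ.< + N ℤ.- + (q * q)
    0<N-q² = subst (ℤ._< + N ℤ.- + (q * q)) (ℤₚ.+-inverseʳ (+ (q * q)))
      (ℤₚ.+-monoˡ-< (ℤ.- + (q * q)) (ℤ.+<+ q²<N))

    f>0 : 0ℤ ℤ.< Triple.f t₀
    f>0 = 0<-*-cancelʳ (Triple.d>0 t₀) (subst (0ℤ ℤ.<_) (Triple.f-eq t₀)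
      (subst₂ (λ c d → 0ℤ ℤ.< + N ℤ.- (c ℤ.+ d) ℤ.* (c ℤ.+ d))
        (sym (root-c q q∣N)) (sym (root-d q q∣N)) (subst (λ k → 0ℤ ℤ.< + N ℤ.- k)
          (ℤₚ.pos-* q q) 0<N-q²)))

    move-right : ∀ {δ} → Move root δ → δ ≡ r
    move-right (right _)    = refl
    move-right (left keeps) = contradiction f>0 (ℤₚ.<-asym (KeepsSign.f<0 keeps))

  -- Induction over the blocks: agreement with the continued fraction.

  module _ {a : ℕ → ℤ} {ζ : ℕ → ℚ√ N} (expansion : IsContinuedFraction (√ N / q) a ζ)
           {φ : ℕ → ℕ} (changes : IsDirectionChanges s φ) where

    open IsContinuedFraction expansion
    open IsDirectionChanges changes using (φ-zero; φ-<)

    private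
      T : ℕ → Triple N
      T n = triple nonSquare t₀ (path n)

      t : ℕ → ℕ
      t n = φ (suc n) ∸ φ n

    -- The induction statement: the block at φ n runs in direction δ, and ζ n is -y* for `r` and
    -- -1/y* for `ℓ`, where y is the label at φ n.
    Agrees : Direction → ℕ → Set
    Agrees δ n = s (φ n) ≡ δ × Surd (ζ n) (num δ (T (φ n))) (den δ (T (φ n)))

    -- One block is one continued fraction step: t n subtractions of 1 leave the fractional part of
    -- ζ n, whose inverse is the surd of the opposite direction.
    agrees-step : ∀ {δ} n → Agrees δ n → a n ≡ + t n × Agrees (opposite δ) (suc n)
    agrees-step {δ} n (s≡δ , ζ-surd) = a≡t , s≡opposite , ζ-suc-surd
      where
      k = φ (suc n)
      c = num δ (T k)
      d = den δ (T k)

      k≡ : φ n ℕ.+ t n ≡ k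
      k≡ = ℕₚ.m+[n∸m]≡n (ℕₚ.<⇒≤ (φ-< n))

      0<e : 0ℤ ℤ.< Triple.e (T k)
      0<e = OnPath.0<e (onLPP k)

      straight : ∀ j → j < t n → s (φ n ℕ.+ j) ≡ δ
      straight j j<t = trans (constant-run changes n j
        (subst (φ n ℕ.+ j <_) k≡ (ℕₚ.+-monoʳ-< (φ n) j<t))) s≡δ

      end-surd : Surd (ζ n) (c ℤ.+ + t n ℤ.* d) d
      end-surd = subst (λ i → Surd (ζ n) (num δ (T i) ℤ.+ + t n ℤ.* den δ (T i)) (den δ (T i)))
        k≡ (surd-run root-onPath (φ n) (t n) straight ζ-surd)

      s≡opposite : s k ≡ opposite δ
      s≡opposite = trans (alternation changes n) (cong opposite s≡δ)

      a≡t : a n ≡ + t n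
      -- At φ (suc n) the path is about to move the other way, so (√N + c)/d lies between 0 and 1.
      a≡t = floor-unique c d (+ t n) (a n) (den-pos δ (T k) 0<e) (num²<N δ (T k) 0<e)
        (N<[num-den]² δ (onLPP k) (subst (Move (path k)) s≡opposite (move (path k) (onLPP k))))
        end-surd (a-floor n)

      cancel : ∀ c m → c ℤ.+ m ℤ.- m ≡ c
      cancel = solve-∀

      fractional : Surd (ζ n ⊖ fromℤ (a n)) c d
      fractional = surd-resp
        (trans (cong (λ m → c ℤ.+ + t n ℤ.* d ℤ.- m ℤ.* d) a≡t) (cancel c (+ t n ℤ.* d)))
        refl (surd-⊖ end-surd (a n))

      ζ-suc-surd : Surd (ζ (suc n)) (num (opposite δ) (T k)) (den (opposite δ) (T k))
      ζ-suc-surd = subst (λ z → Surd z (num (opposite δ) (T k)) (den (opposite δ) (T k))) (sym (ζ-suc n)) (surd-resp (sym (num-opposite δ (T k))) refl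
        (surd-⁻¹ (den (opposite δ) (T k)) (≢-sym (ℤₚ.<⇒≢ (den-pos (opposite δ) (T k) 0<e)))
          (num-den δ (T k)) fractional))

    agrees : ∀ n → Agrees (parity n) n
    -- Since p = 0, α = -α*, so the root's surd for `r` is α itself.
    agrees zero    rewrite φ-zero | ζ-zero =
      starts-right , surd-resp (sym (cong ℤ.-_ (root-c q q∣N))) (sym (root-d q q∣N)) (surd-√/ q)
    agrees (suc n) rewrite parity-suc n = proj₂ (agrees-step n (agrees n))

    partial-quotient : ∀ n → a n ≡ + t n
    partial-quotient n = proj₁ (agrees-step n (agrees n))

    private
      y : ℕ → ℚ√ N
      y n = LPP.x nonSquare q q∣N (φ n)

      y-surd : ∀ n → Surd (y n) (Triple.c (T (φ n))) (Triple.d (T (φ n)))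
      y-surd n = OnPath.value (onLPP (φ n))

    complete-quotient-even : ∀ n → 2 ∣ n → ζ n ≡ ⊝ (y n *̄)
    complete-quotient-even n 2∣n = surd-unique
      (subst (λ δ → Surd (ζ n) (num δ t′) (den δ t′)) (parity-even n 2∣n) (proj₂ (agrees n)))
      (surd-resp refl (ℤₚ.neg-involutive (Triple.d t′)) (surd-⊝ (surd-*̄ (y-surd n))))
      where t′ = T (φ n)

    complete-quotient-odd : ∀ n → ¬ 2 ∣ n → ζ n ≡ ⊝ ((y n *̄) ⁻¹)
    complete-quotient-odd n 2∤n = surd-unique
      (subst (λ δ → Surd (ζ n) (num δ t′) (den δ t′)) (parity-odd n 2∤n) (proj₂ (agrees n)))
      (surd-resp (ℤₚ.neg-involutive c) (ℤₚ.neg-involutive e)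
        -- The conjugate of y is (√N - c)/(-d), and N = (-e)(-d) + (-c)², so its inverse has
        -- denominator -e.
        (surd-⊝ (surd-⁻¹ (ℤ.- e) -e≢0 (trans N-eq (eq c d e)) (surd-*̄ (y-surd n)))))
      where
      t′ = T (φ n)
      open Triple t′ using (c; d; e; N-eq)

      eq : ∀ c d e → e ℤ.* d ℤ.+ c ℤ.* c ≡ ℤ.- e ℤ.* ℤ.- d ℤ.+ ℤ.- c ℤ.* ℤ.- c
      eq = solve-∀

      -e≢0 : ℤ.- e ≢ 0ℤ
      -e≢0 = ℤₚ.<⇒≢ (ℤₚ.neg-mono-< (OnPath.0<e (onLPP (φ n))))

proposition6 : (N : ℕ) .{{_ : NonZero N}} (nonSquare : NonSquare N)
    (q : ℕ) .{{_ : NonZero q}} (q∣N : q ∣ N) → q * q < N →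
    (a : ℕ → ℤ) (ζ : ℕ → ℚ√ N) → IsContinuedFraction (√ N / q) a ζ →
    (φ : ℕ → ℕ) → IsDirectionChanges (LPP.s nonSquare q q∣N) φ →
    let y = λ n → LPP.x nonSquare q q∣N (φ n)
        t = λ n → φ (suc n) ∸ φ n
    in ∀ n →
      ((2 ∣ n → ζ n ≡ ⊝ (y n *̄)) × (¬ (2 ∣ n) → ζ n ≡ ⊝ ((y n *̄) ⁻¹)))
      × a n ≡ + (t n)
proposition6 N nonSquare q q∣N q²<N a ζ expansion φ changes n =
  (complete-quotient-even expansion changes n , complete-quotient-odd expansion changes n) ,
  partial-quotient expansion changes n
  where open Root nonSquare q q∣N q²<N
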